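{- For every integer $n \geq 1$, the number of ascent sequences of length $n$ that avoid the pattern $0021$ equals $$\sum_{k=0}^{n-1}\binom{n-1}{k}C_k,$$ where $C_k=\frac{1}{k+1}\binom{2k}{k}$ is the $k$th Catalan number.
   Context: For an integer string $x_1\cdots x_n$, an ascent is a position $j$ with $x_j<x_{j+1}$; $\mathrm{asc}(x_1\cdots x_n)$ denotes the number of ascents. An ascent sequence of length $n$ is a sequence $x_1\cdots x_n$ of non-negative integers with $x_1=0$ and $x_i\le \mathrm{asc}(x_1\cdots x_{i-1})+1$ for $1<i\le n$. The reduction $\mathrm{red}(x)$ of an integer string $x$ is obtained by replacing every occurrence of the $i$th smallest distinct value of $x$ by $i-1$; a pattern is a reduced string (so patterns may have repeated letters and have minimum letter $0$). A string $x=x_1\cdots x_n$ contains a pattern $p=p_1\cdots p_k$ if there are indices $1\le i_1<\cdots<i_k\le n$ with $\mathrm{red}(x_{i_1}\cdots x_{i_k})=p$; otherwise $x$ avoids $p$. -}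

module Defs where

open import Data.Nat using (ℕ; zero; suc; _+_; _<_; _≤_; _<?_)
open import Data.Nat.Properties using (_≟_)
open import Data.Nat.DivMod using (_/_)
open import Data.Nat.Combinatorics using (_C_)
open import Data.List using (List; []; _∷_; length; map; filter; deduplicate)
open import Data.List.Relation.Binary.Sublist.Propositional using (_⊆_)
open import Data.Product using (_×_; ∃-syntax)
open import Data.Unit using (⊤)
open import Data.Bool using (if_then_else_)
open import Data.Nat using (_<ᵇ_)
open import Relation.Nullary using (¬_)
open import Relation.Binary.PropositionalEquality using (_≡_)

ascFrom : ℕ → List ℕ → ℕ
ascFrom x [] = 0
ascFrom x (y ∷ rest) = (if x <ᵇ y then 1 else 0) + ascFrom y rest

asc : List ℕ → ℕ
asc [] = 0
asc (x ∷ rest) = ascFrom x rest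

data IsAscentFrom : List ℕ → List ℕ → Set where
  done : ∀ {pre} → IsAscentFrom pre []
  step : ∀ {pre x xs} → x ≤ asc pre + 1 →
         IsAscentFrom (pre Data.List.++ (x ∷ [])) xs → IsAscentFrom pre (x ∷ xs)

IsAscentSequence : List ℕ → Set
IsAscentSequence [] = ⊤   -- the empty sequence (length 0; irrelevant for n ≥ 1)
IsAscentSequence (x ∷ xs) = (x ≡ 0) × IsAscentFrom (x ∷ []) xs

red : List ℕ → List ℕ
red x = map (λ v → length (deduplicate _≟_ (filter (_<? v) x))) x

Contains : List ℕ → List ℕ → Set
Contains x p = ∃[ y ] (y ⊆ x × red y ≡ p)

Avoids : List ℕ → List ℕ → Set
Avoids x p = ¬ Contains x p

catalan : ℕ → ℕ
catalan k = ((k + k) C k) / suc k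

{-# OPTIONS --safe #-}
module Submission where

-- Label an avoiding ascent sequence by p, where p + 1 is the number of nonzero letters that
-- may follow it, and let A n be the multiset of labels at length n + 1.  Appending 0 keeps p;
-- prepending 0 to the sequence raised by 1 turns p into p + 1.  These two operations produce
-- every sequence except those with two zeros and a last letter c > 0; for the labels R n of
-- these at length n + 2, each p in A n gives 1, …, p + 1 in R (n + 1) (append 0, then c), and
-- each p in R n gives p (repeat the last letter) and 1, …, p (append a larger one).
-- By induction R n consists of 1, …, p for p in A n, so A (n + 1) consists of p and
-- 1, …, p + 1 for p in A n.  This is the identity plus the Catalan generating tree, and the
-- binomial theorem for the sum of these two operators gives the formula.

open import Defs
open import Data.Bool using (if_then_else_)
open import Data.Nat using (ℕ; zero; suc; _+_; _*_; _∸_; _<_; _≤_; _<?_; _<ᵇ_; z≤n; s≤s; s≤s⁻¹)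
open import Data.Nat.Properties
open import Data.Nat.Combinatorics using (_C_; nCk≡nC[n∸k]; nC1≡n; k>n⇒nCk≡0; nCk+nC[k+1]≡[n+1]C[k+1])
open import Data.Nat.DivMod using (m*n/n≡m; /-congˡ)
open import Data.Nat.ListAction using (sum)
open import Data.Nat.ListAction.Properties using (sum-++)
open import Data.Nat.Tactic.RingSolver using (solve-∀)
open import Data.List using (List; []; _∷_; _++_; map; length; drop; concatMap; filter; deduplicate; reverse; _ʳ++_; applyUpTo; upTo)
open import Data.List.Properties using (map-++; length-map; length-++; length-drop; length-reverse; ∷-injectiveˡ; ∷-injectiveʳ; map-upTo; ++-assoc; ++-identityʳ; filter-accept; filter-reject; filter-none; ʳ++-defn; unfold-reverse; reverse-involutive; reverse-injective)
open import Data.List.Membership.Propositional using (_∈_)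
open import Data.List.Membership.Propositional.Properties using (∈-++⁺ˡ; ∈-++⁺ʳ; ∈-++⁻; ∈-map⁺; ∈-map⁻; ∈-concatMap⁺; ∈-filter⁺; ∈-deduplicate⁺)
open import Data.List.Relation.Unary.All as All using (All; []; _∷_)
import Data.List.Relation.Unary.All.Properties as All
open import Data.List.Relation.Unary.AllPairs as AllPairs using (AllPairs; []; _∷_)
import Data.List.Relation.Unary.AllPairs.Properties as AllPairs
open import Data.List.Relation.Unary.Any as Any using (here; there)
open import Data.List.Relation.Unary.Unique.Propositional using (Unique)
open import Data.List.Relation.Binary.Sublist.Propositional using (_⊆_; []; _∷_; _∷ʳ_; ⊆-refl; lookup)
open import Data.List.Relation.Binary.Sublist.Propositional.Properties using (map⁺; ++⁺ʳ; ∷ˡ⁻; reverse⁺)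
open import Data.Product using (_×_; _,_; proj₁; proj₂; ∃-syntax)
open import Data.Sum using (_⊎_; inj₁; inj₂; [_,_]′)
open import Data.Empty using (⊥-elim)
open import Function using (_∘_)
open import Function.Bundles using (_⇔_; mk⇔)
open import Relation.Nullary using (¬_; ¬?; yes; no; contradiction)
open import Relation.Nullary.Decidable using (dec-true; dec-false)
open import Relation.Binary.Definitions using (tri<; tri≈; tri>)
open import Relation.Binary.PropositionalEquality hiding ([_])
open ≡-Reasoning

-- Binomial sums and Catalan numbers

+-interchange : ∀ a b c d → a + b + (c + d) ≡ a + c + (b + d)
+-interchange = solve-∀

sumBelow : (ℕ → ℕ) → ℕ → ℕ
sumBelow f n = sum (applyUpTo f n)

sumBelow-last : ∀ f n → sumBelow f (suc n) ≡ sumBelow f n + f n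
sumBelow-last f zero    = +-comm (f 0) 0
sumBelow-last f (suc n) = begin
  f 0 + sumBelow (f ∘ suc) (suc n)              ≡⟨ cong (f 0 +_) (sumBelow-last (f ∘ suc) n) ⟩
  f 0 + (sumBelow (f ∘ suc) n + f (suc n))      ≡⟨ +-assoc (f 0) _ _ ⟨
  f 0 + sumBelow (f ∘ suc) n + f (suc n)        ∎

sumBelow-cong : ∀ {f g} → (∀ k → f k ≡ g k) → ∀ n → sumBelow f n ≡ sumBelow g n
sumBelow-cong eq zero    = refl
sumBelow-cong eq (suc n) = cong₂ _+_ (eq 0) (sumBelow-cong (eq ∘ suc) n)

sumBelow-+ : ∀ f g n → sumBelow (λ k → f k + g k) n ≡ sumBelow f n + sumBelow g n
sumBelow-+ f g zero    = refl
sumBelow-+ f g (suc n) rewrite sumBelow-+ (f ∘ suc) (g ∘ suc) n =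
  +-interchange (f 0) (g 0) (sumBelow (f ∘ suc) n) (sumBelow (g ∘ suc) n)

-- Pascal's rule splits each coefficient in two. The result mirrors one step of a sum of two
-- operators: `u` is either kept or moved on by one index.
binomial-sum-suc : ∀ (u : ℕ → ℕ) m →
  sumBelow (λ k → (suc m C k) * u k) (suc (suc m)) ≡
  sumBelow (λ k → (m C k) * u k) (suc m) + sumBelow (λ k → (m C k) * u (suc k)) (suc m)
binomial-sum-suc u m = begin
  (suc m C 0) * u 0 + sumBelow (λ k → (suc m C suc k) * u (suc k)) (suc m)
    ≡⟨ cong ((m C 0) * u 0 +_) (sumBelow-cong pascal (suc m)) ⟩
  (m C 0) * u 0 + sumBelow (λ k → lower k + upper k) (suc m)
    ≡⟨ cong ((m C 0) * u 0 +_) (sumBelow-+ lower upper (suc m)) ⟩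
  (m C 0) * u 0 + (sumBelow lower (suc m) + sumBelow upper (suc m))
    ≡⟨ swap ((m C 0) * u 0) (sumBelow lower (suc m)) (sumBelow upper (suc m)) ⟩
  sumBelow (λ k → (m C k) * u k) (suc (suc m)) + sumBelow lower (suc m)
    -- The summand split off here has coefficient `m C suc m`, which is 0.
    ≡⟨ cong (_+ sumBelow lower (suc m)) (sumBelow-last (λ k → (m C k) * u k) (suc m)) ⟩
  sumBelow (λ k → (m C k) * u k) (suc m) + (m C suc m) * u (suc m) + sumBelow lower (suc m)
    ≡⟨ cong (λ b → sumBelow (λ k → (m C k) * u k) (suc m) + b * u (suc m) + sumBelow lower (suc m))
            (k>n⇒nCk≡0 (n<1+n m)) ⟩
  sumBelow (λ k → (m C k) * u k) (suc m) + 0 + sumBelow lower (suc m)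
    ≡⟨ cong (_+ sumBelow lower (suc m)) (+-identityʳ (sumBelow (λ k → (m C k) * u k) (suc m))) ⟩
  sumBelow (λ k → (m C k) * u k) (suc m) + sumBelow lower (suc m) ∎
  where
  lower upper : ℕ → ℕ
  lower k = (m C k) * u (suc k)
  upper k = (m C suc k) * u (suc k)
  pascal : ∀ k → (suc m C suc k) * u (suc k) ≡ lower k + upper k
  pascal k = trans (cong (_* u (suc k)) (sym (nCk+nC[k+1]≡[n+1]C[k+1] m k)))
                   (*-distribʳ-+ (u (suc k)) (m C k) (m C suc k))
  swap : ∀ a b c → a + (b + c) ≡ a + c + b
  swap = solve-∀

-- Induction on n by Pascal's rule keeps the identity free of factorials and division.
C-absorb : ∀ n k → suc k * (suc n C suc k) ≡ suc n * (n C k)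
C-absorb zero    zero    = refl
C-absorb zero    (suc k) = begin
  suc (suc k) * (1 C suc (suc k)) ≡⟨ cong (suc (suc k) *_) (k>n⇒nCk≡0 {1} {suc (suc k)} (s≤s (s≤s z≤n))) ⟩
  suc (suc k) * 0                 ≡⟨ *-zeroʳ (suc (suc k)) ⟩
  0                               ≡⟨ *-zeroʳ 1 ⟨
  1 * 0                           ≡⟨ cong (1 *_) (k>n⇒nCk≡0 {0} {suc k} (s≤s z≤n)) ⟨
  1 * (0 C suc k)                 ∎
C-absorb (suc n) zero    = begin
  1 * (suc (suc n) C 1)               ≡⟨ cong (1 *_) (nCk+nC[k+1]≡[n+1]C[k+1] (suc n) 0) ⟨
  1 * ((suc n C 0) + (suc n C 1))     ≡⟨ *-distribˡ-+ 1 (suc n C 0) (suc n C 1) ⟩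
  1 * (suc n C 0) + 1 * (suc n C 1)   ≡⟨ cong (1 * (suc n C 0) +_) (C-absorb n 0) ⟩
  1 * (n C 0) + suc n * (n C 0)       ≡⟨ *-distribʳ-+ (n C 0) 1 (suc n) ⟨
  suc (suc n) * (suc n C 0)           ∎
C-absorb (suc n) (suc k) = begin
  suc (suc k) * (suc (suc n) C suc (suc k))
    ≡⟨ cong (suc (suc k) *_) (nCk+nC[k+1]≡[n+1]C[k+1] (suc n) (suc k)) ⟨
  suc (suc k) * (b + (suc n C suc (suc k)))
    ≡⟨ *-distribˡ-+ (suc (suc k)) b (suc n C suc (suc k)) ⟩
  b + suc k * b + suc (suc k) * (suc n C suc (suc k))
    ≡⟨ cong₂ (λ p q → b + p + q) (C-absorb n k) (C-absorb n (suc k)) ⟩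
  b + suc n * (n C k) + suc n * (n C suc k)
    ≡⟨ +-assoc b _ _ ⟩
  b + (suc n * (n C k) + suc n * (n C suc k))
    ≡⟨ cong (b +_) (*-distribˡ-+ (suc n) (n C k) (n C suc k)) ⟨
  b + suc n * ((n C k) + (n C suc k))
    ≡⟨ cong (λ p → b + suc n * p) (nCk+nC[k+1]≡[n+1]C[k+1] n k) ⟩
  suc (suc n) * b ∎
  where
  b = suc n C suc k

-- The sum starts at f 1 and omits f 0, because the labels to be summed over are 1, ..., p.
partialSum : (ℕ → ℕ) → ℕ → ℕ
partialSum f zero    = 0
partialSum f (suc p) = partialSum f p + f (suc p)

catalanStep : (ℕ → ℕ) → ℕ → ℕ
catalanStep f p = partialSum f (suc p)

partialSum-+ : ∀ f g p → partialSum (λ i → f i + g i) p ≡ partialSum f p + partialSum g p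
partialSum-+ f g zero    = refl
partialSum-+ f g (suc p) rewrite partialSum-+ f g p =
  +-interchange (partialSum f p) (partialSum g p) (f (suc p)) (g (suc p))

-- The number of k-step descendants of label p in the Catalan generating tree p ↦ 1, …, p + 1.
ballot : ℕ → ℕ → ℕ
ballot zero    p = 1
ballot (suc k) p = catalanStep (ballot k) p

-- The reflection formula C(n, k+1) - C(n, k) with n = 2k + 2 + p, written additively to avoid
-- truncated subtraction. Each step of the induction on k and p adds instances of Pascal's rule.
ballot-C : ∀ k p → ballot (suc k) p + ((suc k + suc k + p) C k) ≡ ((suc k + suc k + p) C suc k)
ballot-C zero p = begin
  partialSum (λ _ → 1) (suc p) + ((2 + p) C 0) ≡⟨ cong₂ _+_ (partialSum-1 (suc p)) refl ⟩
  suc p + 1                                    ≡⟨ +-comm (suc p) 1 ⟩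
  2 + p                                        ≡⟨ nC1≡n (2 + p) ⟨
  (2 + p) C 1                                  ∎
  where
  partialSum-1 : ∀ q → partialSum (λ _ → 1) q ≡ q
  partialSum-1 zero    = refl
  partialSum-1 (suc q) = trans (cong (_+ 1) (partialSum-1 q)) (+-comm q 1)
ballot-C (suc k) zero = begin
  ballot (suc k) 1 + (M C suc k)                             ≡⟨ cong (ballot (suc k) 1 +_) pascalˡ ⟨
  ballot (suc k) 1 + ((N C k) + (N C suc k))                 ≡⟨ +-assoc (ballot (suc k) 1) _ _ ⟨
  ballot (suc k) 1 + (N C k) + (N C suc k)                   ≡⟨ cong (_+ (N C suc k)) IH ⟩
  -- Here N = 2k + 3 is odd, so its two middle coefficients agree.
  (N C suc k) + (N C suc k)                                  ≡⟨ cong ((N C suc k) +_) symmetric ⟩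
  (N C suc k) + (N C suc (suc k))                            ≡⟨ nCk+nC[k+1]≡[n+1]C[k+1] N (suc k) ⟩
  suc N C suc (suc k)                                        ≡⟨ cong (_C suc (suc k)) sucN≡M ⟩
  M C suc (suc k)                                            ∎
  where
  M = suc (suc k) + suc (suc k) + 0
  N = suc k + suc k + 1
  sucN≡M : suc N ≡ M
  sucN≡M = arith k
    where
    arith : ∀ k → suc (suc k + suc k + 1) ≡ suc (suc k) + suc (suc k) + 0
    arith = solve-∀
  pascalˡ : (N C k) + (N C suc k) ≡ M C suc k
  pascalˡ = trans (nCk+nC[k+1]≡[n+1]C[k+1] N k) (cong (_C suc k) sucN≡M)
  IH : ballot (suc k) 1 + (N C k) ≡ (N C suc k)
  IH = ballot-C k 1
  N-split : N ≡ suc k + suc (suc k)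
  N-split = arith k
    where
    arith : ∀ k → suc k + suc k + 1 ≡ suc k + suc (suc k)
    arith = solve-∀
  symmetric : (N C suc k) ≡ (N C suc (suc k))
  symmetric = trans (nCk≡nC[n∸k] {suc k} {N} (subst (suc k ≤_) (sym N-split) (m≤m+n (suc k) _)))
    (cong (N C_) (trans (cong (_∸ suc k) N-split) (m+n∸m≡n (suc k) (suc (suc k)))))
ballot-C (suc k) (suc p) = begin
  ballot (suc (suc k)) p + ballot (suc k) (2 + p) + (suc N′ C suc k)
    ≡⟨ cong (ballot (suc (suc k)) p + ballot (suc k) (2 + p) +_)
         (trans (cong (_C suc k) sucN) (sym (nCk+nC[k+1]≡[n+1]C[k+1] N k))) ⟩
  ballot (suc (suc k)) p + ballot (suc k) (2 + p) + ((N C k) + (N C suc k))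
    ≡⟨ shuffle (ballot (suc (suc k)) p) (ballot (suc k) (2 + p)) (N C k) (N C suc k) ⟩
  (ballot (suc (suc k)) p + (N C suc k)) + (ballot (suc k) (2 + p) + (N C k))
    ≡⟨ cong₂ _+_ (ballot-C (suc k) p) IH ⟩
  (N C suc (suc k)) + (N C suc k)
    ≡⟨ +-comm (N C suc (suc k)) (N C suc k) ⟩
  (N C suc k) + (N C suc (suc k))
    ≡⟨ nCk+nC[k+1]≡[n+1]C[k+1] N (suc k) ⟩
  suc N C suc (suc k)
    ≡⟨ cong (_C suc (suc k)) sucN ⟨
  suc N′ C suc (suc k) ∎
  where
  N  = suc (suc k) + suc (suc k) + p
  N′ = suc k + suc (suc k) + suc p
  sucN : suc N′ ≡ suc N
  sucN = arith k p
    where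
    arith : ∀ k p → suc (suc k + suc (suc k) + suc p) ≡ suc (suc (suc k) + suc (suc k) + p)
    arith = solve-∀
  IH : ballot (suc k) (2 + p) + (N C k) ≡ (N C suc k)
  IH = subst (λ n → ballot (suc k) (2 + p) + (n C k) ≡ (n C suc k)) (arith k p) (ballot-C k (2 + p))
    where
    arith : ∀ k p → suc k + suc k + (2 + p) ≡ suc (suc k) + suc (suc k) + p
    arith = solve-∀
  shuffle : ∀ a b c d → a + b + (c + d) ≡ (a + d) + (b + c)
  shuffle = solve-∀

-- With n = 2k + 2, absorption gives (k + 1) C(n, k+1) = (k + 2) C(n, k), so
-- (k + 2) (C(n, k+1) − C(n, k)) = C(n, k+1), the central binomial coefficient.
ballot-catalan : ∀ k → ballot k 0 ≡ catalan k
ballot-catalan zero    = refl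
ballot-catalan (suc k) = sym (trans (/-congˡ {o = suc (suc k)} (sym scaled)) (m*n/n≡m (ballot (suc k) 0) (suc (suc k))))
  where
  n = suc k + suc k
  b = ballot (suc k) 0
  x = n C k
  y = n C suc k
  ballot≡ : b + x ≡ y
  ballot≡ = subst (λ n → b + (n C k) ≡ (n C suc k)) (+-identityʳ n) (ballot-C k 0)
  absorbed : suc k * y ≡ suc (suc k) * x
  absorbed = +-cancelˡ-≡ (suc k * x) _ _ (begin
    suc k * x + suc k * y          ≡⟨ *-distribˡ-+ (suc k) x y ⟨
    suc k * (x + y)                ≡⟨ cong (suc k *_) (nCk+nC[k+1]≡[n+1]C[k+1] n k) ⟩
    suc k * (suc n C suc k)        ≡⟨ C-absorb n k ⟩
    suc n * x                      ≡⟨ arith k x ⟩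
    suc k * x + suc (suc k) * x    ∎)
    where
    arith : ∀ k x → suc (suc k + suc k) * x ≡ suc k * x + suc (suc k) * x
    arith = solve-∀
  scaled : b * suc (suc k) ≡ y
  scaled = +-cancelʳ-≡ (suc (suc k) * x) _ _ (begin
    b * suc (suc k) + suc (suc k) * x ≡⟨ arith k b x ⟩
    suc (suc k) * (b + x)             ≡⟨ cong (suc (suc k) *_) ballot≡ ⟩
    y + suc k * y                     ≡⟨ cong (y +_) absorbed ⟩
    y + suc (suc k) * x               ∎)
    where
    arith : ∀ k b x → b * suc (suc k) + suc (suc k) * x ≡ suc (suc k) * (b + x)
    arith = solve-∀

-- Reversed words

-- Words are stored with the last letter first, so that appending a letter is _∷_.

rise : ℕ → List ℕ → ℕ
rise c []      = 0
rise c (d ∷ r) = if d <ᵇ c then 1 else 0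

ascᴿ : List ℕ → ℕ
ascᴿ []      = 0
ascᴿ (c ∷ r) = rise c r + ascᴿ r

-- Appending c would complete an occurrence of 0021 with c as its 1; d is the 2 and the two copies
-- of a are the 00, listed backwards.
Forbidden : List ℕ → ℕ → Set
Forbidden r c = ∃[ a ] ∃[ d ] (a < c × c < d × d ∷ a ∷ a ∷ [] ⊆ r)

data Valid : List ℕ → Set where
  start : Valid (0 ∷ [])
  snoc  : ∀ {c r} → c ≤ suc (ascᴿ r) → ¬ Forbidden r c → Valid r → Valid (c ∷ r)

TwoZeros : List ℕ → Set
TwoZeros r = 0 ∷ 0 ∷ [] ⊆ r

rise-< : ∀ {d c r} → d < c → rise c (d ∷ r) ≡ 1
rise-< {d} {c} d<c rewrite dec-true (d <? c) d<c = refl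

rise-≥ : ∀ {d c r} → c ≤ d → rise c (d ∷ r) ≡ 0
rise-≥ {d} {c} c≤d rewrite dec-false (d <? c) (≤⇒≯ c≤d) = refl

valid-head-zero : ∀ {r} → Valid r → ascᴿ (0 ∷ r) ≡ ascᴿ r
valid-head-zero start                   = refl
valid-head-zero (snoc {zero}  _ _ _)    = refl
valid-head-zero (snoc {suc c} _ _ _)    = refl

-- A letter that makes an ascent is at most the old number of ascents plus one, which is the new
-- number; any other letter is at most its predecessor.
valid-≤asc : ∀ {r} → Valid r → All (_≤ ascᴿ r) r
valid-≤asc start = z≤n ∷ []
valid-≤asc (snoc {c} {[]} c≤ _ ())
valid-≤asc (snoc {c} {d ∷ r} c≤ _ v) with d <? c
... | yes d<c rewrite rise-< {r = r} d<c = c≤ ∷ All.map m≤n⇒m≤1+n (valid-≤asc v)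
... | no  d≮c rewrite rise-≥ {r = r} (≮⇒≥ d≮c) =
  ≤-trans (≮⇒≥ d≮c) (All.head (valid-≤asc v)) ∷ valid-≤asc v

-- This letter exceeds all earlier ones, so none of them can be the 2 above it.
top-allowed : ∀ {r} → Valid r → ¬ Forbidden r (suc (ascᴿ r))
top-allowed v (a , d , _ , top<d , daa) =
  <⇒≱ top<d (m≤n⇒m≤1+n (All.lookup (valid-≤asc v) (lookup daa (here refl))))

zero-allowed : ∀ {r} → ¬ Forbidden r 0
zero-allowed (_ , _ , () , _)

valid-∋0 : ∀ {r} → Valid r → 0 ∷ [] ⊆ r
valid-∋0 start        = ⊆-refl
valid-∋0 (snoc _ _ v) = _ ∷ʳ valid-∋0 v

forbidden-∷ : ∀ {r c e} → Forbidden r e → Forbidden (c ∷ r) e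
forbidden-∷ (a , d , a<e , e<d , daa) = a , d , a<e , e<d , _ ∷ʳ daa

forbidden-∷⁻ : ∀ {r c e} → Forbidden (c ∷ r) e → e < c ⊎ Forbidden r e
forbidden-∷⁻ (a , d , a<e , e<d , (_ ∷ʳ daa)) = inj₂ (a , d , a<e , e<d , daa)
forbidden-∷⁻ (a , d , a<e , e<d , (refl ∷ _)) = inj₁ e<d

-- The two zeros are the 00, c is the 2 and e is the 1.
forbidden-below : ∀ {r c e} → TwoZeros r → 0 < e → e < c → Forbidden (c ∷ r) e
forbidden-below 00⊆r 0<e e<c = 0 , _ , 0<e , e<c , refl ∷ 00⊆r

-- An occurrence with the new copy of l as its 2 can use the old copy instead: its 00 is smaller
-- than l, hence lies in r.
forbidden-repeat⁻ : ∀ {l r e} → Forbidden (l ∷ l ∷ r) e → Forbidden (l ∷ r) e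
forbidden-repeat⁻ (a , d , a<e , e<d , (_ ∷ʳ daa))            = a , d , a<e , e<d , daa
forbidden-repeat⁻ (a , d , a<e , e<d , (refl ∷ (_ ∷ʳ aa)))    = a , d , a<e , e<d , refl ∷ aa
forbidden-repeat⁻ (a , d , a<e , e<d , (refl ∷ (refl ∷ _)))   = contradiction (<-trans a<e e<d) (<-irrefl refl)

twoZeros-suc⁻ : ∀ {c r} → TwoZeros (suc c ∷ r) → TwoZeros r
twoZeros-suc⁻ (_ ∷ʳ 00⊆r) = 00⊆r

-- Prepends 0 to the raised word: under reversed storage the first letter comes last.
shift : List ℕ → List ℕ
shift r = map suc r ++ 0 ∷ []

shift-injective : ∀ {r s} → shift r ≡ shift s → r ≡ s
shift-injective {[]}    {[]}    _    = refl
shift-injective {[]}    {_ ∷ []}    ()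
shift-injective {[]}    {_ ∷ _ ∷ _} ()
shift-injective {_ ∷ []}    {[]}    ()
shift-injective {_ ∷ _ ∷ _} {[]}    ()
shift-injective {c ∷ r} {d ∷ s} eq   =
  cong₂ _∷_ (suc-injective (∷-injectiveˡ eq)) (shift-injective (∷-injectiveʳ eq))

ascᴿ-shift : ∀ {r} → Valid r → ascᴿ (shift r) ≡ suc (ascᴿ r)
ascᴿ-shift start = refl
ascᴿ-shift (snoc {c} {[]} _ _ ())
ascᴿ-shift (snoc {c} {d ∷ r} _ _ v) =
  trans (cong (rise c (d ∷ r) +_) (ascᴿ-shift v)) (+-suc (rise c (d ∷ r)) _)

shift-⊆⁻ : ∀ {ds r} → map suc ds ⊆ shift r → ds ⊆ r
shift-⊆⁻ {[]}    {[]}    _           = []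
shift-⊆⁻ {_ ∷ _} {[]}    (_ ∷ʳ ())
shift-⊆⁻ {ds}    {c ∷ r} (_ ∷ʳ p)    = c ∷ʳ shift-⊆⁻ p
shift-⊆⁻ {d ∷ ds} {c ∷ r} (refl ∷ p) = refl ∷ shift-⊆⁻ p

shift-one-zero : ∀ r → ¬ TwoZeros (shift r)
shift-one-zero []      (_ ∷ʳ ())
shift-one-zero []      (_ ∷ ())
shift-one-zero (c ∷ r) (_ ∷ʳ p) = shift-one-zero r p

forbidden-shift : ∀ {r c} → Forbidden r c → Forbidden (shift r) (suc c)
forbidden-shift (a , d , a<c , c<d , daa) =
  suc a , suc d , s≤s a<c , s≤s c<d , ++⁺ʳ _ (map⁺ suc daa)

-- The repeated small letter cannot be 0, since the shifted word has a single 0; hence all three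
-- letters are raised letters of r.
forbidden-shift⁻ : ∀ {r c} → Forbidden (shift r) (suc c) → Forbidden r c
forbidden-shift⁻ {r} (zero  , _     , _   , _   , daa) = contradiction (∷ˡ⁻ daa) (shift-one-zero r)
forbidden-shift⁻     (suc a , suc d , a<c , c<d , daa) = a , d , s≤s⁻¹ a<c , s≤s⁻¹ c<d , shift-⊆⁻ daa

valid-shift : ∀ {r} → Valid r → Valid (shift r)
valid-shift start = snoc (s≤s z≤n) (λ { (_ , _ , _ , _ , (_ ∷ʳ ())) ; (_ , _ , _ , _ , (_ ∷ ())) }) start
valid-shift (snoc {c} {r} c≤ ok v) =
  snoc (subst (suc c ≤_) (cong suc (sym (ascᴿ-shift v))) (s≤s c≤))
       (ok ∘ forbidden-shift⁻)
       (valid-shift v)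

valid-cases : ∀ {r} → Valid r → TwoZeros r ⊎ r ≡ 0 ∷ [] ⊎ ∃[ s ] (r ≡ shift s × Valid s)
valid-cases start                = inj₂ (inj₁ refl)
valid-cases (snoc {zero}  _ _ v) = inj₁ (refl ∷ valid-∋0 v)
valid-cases (snoc {suc c} c≤ ok v) with valid-cases v
... | inj₁ 00⊆r                     = inj₁ (_ ∷ʳ 00⊆r)
... | inj₂ (inj₁ refl) with c≤
-- The ascent bound leaves only the letter 1, and the word 01 is the shift of the word 0.
...   | s≤s z≤n                     = inj₂ (inj₂ (0 ∷ [] , refl , start))
valid-cases (snoc {suc c} c≤ ok v) | inj₂ (inj₂ (s , refl , w)) =
  inj₂ (inj₂ (c ∷ s , refl ,
    snoc (s≤s⁻¹ (subst (λ t → suc c ≤ suc t) (ascᴿ-shift w) c≤)) (ok ∘ forbidden-shift) w))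

-- Admissible letters

-- With t = ascᴿ r, the list vs omits the letter ascᴿ r + 1, which may always follow.
record Admissible (t : ℕ) (r vs : List ℕ) : Set where
  field
    increasing : AllPairs _<_ vs
    sound      : ∀ {e} → e ∈ vs → 0 < e × e ≤ t × ¬ Forbidden r e
    complete   : ∀ {e} → 0 < e → e ≤ t → ¬ Forbidden r e → e ∈ vs
open Admissible public

-- With the bound raised to t + 1 the list holds every nonzero letter that may follow. This bound is
-- also the ascent count after a letter that makes an ascent.
admissible-top : ∀ {t r vs} → Admissible t r vs → ¬ Forbidden r (suc t) →
                 Admissible (suc t) r (vs ++ suc t ∷ [])
admissible-top {t} {r} {vs} adm ok = record
  { increasing = AllPairs.++⁺ (increasing adm) ([] ∷ [])
                   (All.tabulate λ e∈vs → s≤s (proj₁ (proj₂ (sound adm e∈vs))) ∷ [])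
  ; sound      = λ e∈ → [ old , (λ { (here refl) → s≤s z≤n , ≤-refl , ok }) ]′ (∈-++⁻ vs e∈)
  ; complete   = comp
  }
  where
  old : ∀ {e} → e ∈ vs → 0 < e × e ≤ suc t × ¬ Forbidden r e
  old e∈vs with sound adm e∈vs
  ... | 0<e , e≤t , ok′ = 0<e , m≤n⇒m≤1+n e≤t , ok′
  comp : ∀ {e} → 0 < e → e ≤ suc t → ¬ Forbidden r e → e ∈ vs ++ suc t ∷ []
  comp 0<e e≤ ok′ with m≤n⇒m<n∨m≡n e≤
  ... | inj₁ e<  = ∈-++⁺ˡ (complete adm 0<e (s≤s⁻¹ e<) ok′)
  ... | inj₂ refl = ∈-++⁺ʳ vs (here refl)

admissible-zero : ∀ {t r vs} → Admissible t r vs → Admissible t (0 ∷ r) vs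
admissible-zero adm = record
  { increasing = increasing adm
  ; sound      = λ e∈ → let (0<e , e≤t , ok) = sound adm e∈ in
                   0<e , e≤t , λ bad → [ (λ ()) , ok ]′ (forbidden-∷⁻ bad)
  ; complete   = λ 0<e e≤t ok → complete adm 0<e e≤t (ok ∘ forbidden-∷)
  }

admissible-repeat : ∀ {t l r vs} → Admissible t (l ∷ r) vs → Admissible t (l ∷ l ∷ r) vs
admissible-repeat adm = record
  { increasing = increasing adm
  ; sound      = λ e∈ → let (0<e , e≤t , ok) = sound adm e∈ in 0<e , e≤t , ok ∘ forbidden-repeat⁻
  ; complete   = λ 0<e e≤t ok → complete adm 0<e e≤t (ok ∘ forbidden-∷)
  }

-- Raised letters keep their status. The letter 1 joins them, since an occurrence ending in it would
-- need two zeros, and the shifted word has one.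
admissible-shift : ∀ {t r vs} → Admissible t r vs → Admissible (suc t) (shift r) (1 ∷ map suc vs)
admissible-shift {t} {r} {vs} adm = record
  { increasing = All.map⁺ (All.tabulate λ e∈ → s≤s (proj₁ (sound adm e∈)))
                 ∷ AllPairs.map⁺ (AllPairs.map s≤s (increasing adm))
  ; sound      = snd
  ; complete   = comp
  }
  where
  snd : ∀ {e} → e ∈ 1 ∷ map suc vs → 0 < e × e ≤ suc t × ¬ Forbidden (shift r) e
  snd (here refl) = s≤s z≤n , s≤s z≤n , zero-allowed ∘ forbidden-shift⁻
  snd (there e∈) with ∈-map⁻ suc e∈
  ... | e , e∈vs , refl with sound adm e∈vs
  ...   | 0<e , e≤t , ok = s≤s z≤n , s≤s e≤t , ok ∘ forbidden-shift⁻
  comp : ∀ {e} → 0 < e → e ≤ suc t → ¬ Forbidden (shift r) e → e ∈ 1 ∷ map suc vs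
  comp {suc zero}    _ _  _  = here refl
  comp {suc (suc e)} _ e≤ ok = there (∈-map⁺ suc (complete adm (s≤s z≤n) (s≤s⁻¹ e≤) (ok ∘ forbidden-shift)))

-- Letters listed before c become forbidden, with c as the 2 over two zeros. Letters from c on are
-- not below c, so c cannot be the 2 of an occurrence ending in them.
admissible-suffix : ∀ {t r} ps {c us} → TwoZeros r → Admissible t r (ps ++ c ∷ us) → Admissible t (c ∷ r) (c ∷ us)
admissible-suffix {t} {r} ps {c} {us} 00⊆r adm = record
  { increasing = suffix-increasing ps (increasing adm)
  ; sound      = λ e∈ → let (0<e , e≤t , ok) = sound adm (∈-++⁺ʳ ps e∈) in
                   0<e , e≤t , λ bad → [ ≤⇒≯ (c≤ e∈) , ok ]′ (forbidden-∷⁻ bad)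
  ; complete   = λ {e} 0<e e≤t ok →
                   [ (λ e∈ps → ⊥-elim (ok (forbidden-below 00⊆r 0<e (prefix-< ps (increasing adm) e∈ps))))
                   , (λ e∈ → e∈) ]′ (∈-++⁻ ps (complete adm 0<e e≤t (ok ∘ forbidden-∷)))
  }
  where
  suffix-increasing : ∀ ps → AllPairs _<_ (ps ++ c ∷ us) → AllPairs _<_ (c ∷ us)
  suffix-increasing []       inc       = inc
  suffix-increasing (_ ∷ ps) (_ ∷ inc) = suffix-increasing ps inc
  prefix-< : ∀ ps {e} → AllPairs _<_ (ps ++ c ∷ us) → e ∈ ps → e < c
  prefix-< (p ∷ ps) (p< ∷ _)  (here refl) = All.lookup p< (∈-++⁺ʳ ps (here refl))
  prefix-< (_ ∷ ps) (_ ∷ inc) (there e∈)  = prefix-< ps inc e∈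
  c≤ : ∀ {e} → e ∈ c ∷ us → c ≤ e
  c≤ (here refl) = ≤-refl
  c≤ (there e∈)  = <⇒≤ (All.lookup (AllPairs.head (suffix-increasing ps (increasing adm))) e∈)

-- The generating tree

-- A reversed word r together with the list vs such that Admissible (ascᴿ r) r vs.
Node : Set
Node = List ℕ × List ℕ

allowed : Node → List ℕ
allowed (r , vs) = vs ++ suc (ascᴿ r) ∷ []

appendZero prependZero repeatLast : Node → Node
appendZero  (r , vs) = 0 ∷ r , vs
prependZero (r , vs) = shift r , 1 ∷ map suc vs
-- A default value: words in the tree are never empty.
repeatLast  ([] , vs)    = [] , vs
repeatLast  (l ∷ r , vs) = l ∷ l ∷ r , vs

-- Once two zeros are present, appending a new maximum c forbids exactly the smaller
-- nonzero letters, so what remains admissible is the suffix starting at c.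
appendEach : List ℕ → List ℕ → List Node
appendEach r []       = []
appendEach r (c ∷ us) = (c ∷ r , c ∷ us) ∷ appendEach r us

-- `afterZero` makes two moves at once, a 0 and then a nonzero letter. The 0 changes neither the
-- ascent count nor the admissible letters, so those of u serve.
afterZero afterNonzero : Node → List Node
afterZero    u = appendEach (0 ∷ proj₁ u) (allowed u)
-- In a risen word the last letter heads its own list; `repeatLast` treats that letter and `drop 1`
-- leaves the larger ones.
afterNonzero u = repeatLast u ∷ appendEach (proj₁ u) (drop 1 (allowed u))

-- nodes n enumerates the words of length n + 1: those ending in a repeated 0, those with
-- a single 0, and (risen) those with at least two zeros but a nonzero last letter.
-- The last class has no words of length 1, so risen is indexed to have length n + 2.
mutual
  nodes : ℕ → List Node
  nodes zero    = (0 ∷ [] , []) ∷ []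
  nodes (suc n) = map appendZero (nodes n) ++ map prependZero (nodes n) ++ risen n

  risen : ℕ → List Node
  risen zero    = []
  risen (suc n) = concatMap afterZero (nodes n) ++ concatMap afterNonzero (risen n)

-- Counting words by label

-- Evaluating against an arbitrary f records the multiset of the numbers |vs|.
weight : (ℕ → ℕ) → List Node → ℕ
weight f us = sum (map (λ u → f (length (proj₂ u))) us)

weight-++ : ∀ f us ws → weight f (us ++ ws) ≡ weight f us + weight f ws
weight-++ f us ws = trans (cong sum (map-++ _ us ws)) (sum-++ (map _ us) (map _ ws))

weight-map : ∀ f g (h : Node → Node) → (∀ u → f (length (proj₂ (h u))) ≡ g (length (proj₂ u))) →
             ∀ us → weight f (map h us) ≡ weight g us
weight-map f g h eq []       = refl
weight-map f g h eq (u ∷ us) = cong₂ _+_ (eq u) (weight-map f g h eq us)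

weight-concatMap : ∀ f g (h : Node → List Node) → (∀ u → weight f (h u) ≡ g (length (proj₂ u))) →
                   ∀ us → weight f (concatMap h us) ≡ weight g us
weight-concatMap f g h eq []       = refl
weight-concatMap f g h eq (u ∷ us) =
  trans (weight-++ f (h u) (concatMap h us)) (cong₂ _+_ (eq u) (weight-concatMap f g h eq us))

weight-+ : ∀ f g us → weight (λ p → f p + g p) us ≡ weight f us + weight g us
weight-+ f g []       = refl
weight-+ f g (u ∷ us) rewrite weight-+ f g us =
  +-interchange (f (length (proj₂ u))) (g (length (proj₂ u))) (weight f us) (weight g us)

weight-appendEach : ∀ f r us → weight f (appendEach r us) ≡ partialSum f (length us)
weight-appendEach f r []       = refl
weight-appendEach f r (c ∷ us) =
  trans (cong (f (suc (length us)) +_) (weight-appendEach f r us)) (+-comm (f (suc (length us))) _)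

length-allowed : ∀ u → length (allowed u) ≡ suc (length (proj₂ u))
length-allowed (r , vs) = trans (length-++ vs) (+-comm (length vs) 1)

weight-afterZero : ∀ f u → weight f (afterZero u) ≡ catalanStep f (length (proj₂ u))
weight-afterZero f u = trans (weight-appendEach f _ (allowed u)) (cong (partialSum f) (length-allowed u))

weight-afterNonzero : ∀ f u →
  weight f (afterNonzero u) ≡ f (length (proj₂ u)) + partialSum f (length (proj₂ u))
weight-afterNonzero f u@(r , vs) = cong₂ _+_ (cong f (label r)) (trans
  (weight-appendEach f r (drop 1 (allowed u)))
  (cong (partialSum f) (trans (length-drop 1 (allowed u)) (cong (λ n → n ∸ 1) (length-allowed u)))))
  where
  label : ∀ r → length (proj₂ (repeatLast (r , vs))) ≡ length vs
  label []      = refl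
  label (_ ∷ _) = refl

weight-nodes-suc : ∀ f n → weight f (nodes (suc n)) ≡
                   weight f (nodes n) + weight (f ∘ suc) (nodes n) + weight f (risen n)
weight-nodes-suc f n = begin
  weight f (map appendZero (nodes n) ++ map prependZero (nodes n) ++ risen n)
    ≡⟨ weight-++ f (map appendZero (nodes n)) _ ⟩
  weight f (map appendZero (nodes n)) + weight f (map prependZero (nodes n) ++ risen n)
    ≡⟨ cong (weight f (map appendZero (nodes n)) +_) (weight-++ f (map prependZero (nodes n)) (risen n)) ⟩
  weight f (map appendZero (nodes n)) + (weight f (map prependZero (nodes n)) + weight f (risen n))
    ≡⟨ +-assoc (weight f (map appendZero (nodes n))) _ _ ⟨
  weight f (map appendZero (nodes n)) + weight f (map prependZero (nodes n)) + weight f (risen n)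
    ≡⟨ cong₂ (λ a b → a + b + weight f (risen n))
         (weight-map f f appendZero (λ _ → refl) (nodes n))
         (weight-map f (f ∘ suc) prependZero (λ u → cong (f ∘ suc) (length-map suc (proj₂ u))) (nodes n)) ⟩
  weight f (nodes n) + weight (f ∘ suc) (nodes n) + weight f (risen n) ∎

weight-risen-suc : ∀ f n → weight f (risen (suc n)) ≡
                   weight (catalanStep f) (nodes n) + (weight f (risen n) + weight (partialSum f) (risen n))
weight-risen-suc f n = trans (weight-++ f (concatMap afterZero (nodes n)) _) (cong₂ _+_
  (weight-concatMap f (catalanStep f) afterZero (weight-afterZero f) (nodes n))
  (trans (weight-concatMap f (λ p → f p + partialSum f p) afterNonzero (weight-afterNonzero f) (risen n))
         (weight-+ f (partialSum f) (risen n))))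

-- After the induction hypothesis for f, the recurrence of `risen` at f becomes that of `nodes` at
-- `partialSum f`, because `partialSum f ∘ suc` is `catalanStep f` by definition.
weight-risen : ∀ f n → weight f (risen n) ≡ weight (partialSum f) (nodes n)
weight-risen f zero    = refl
weight-risen f (suc n) = begin
  weight f (risen (suc n))
    ≡⟨ weight-risen-suc f n ⟩
  weight (catalanStep f) (nodes n) + (weight f (risen n) + weight (partialSum f) (risen n))
    ≡⟨ cong (λ w → weight (catalanStep f) (nodes n) + (w + weight (partialSum f) (risen n))) (weight-risen f n) ⟩
  weight (catalanStep f) (nodes n) + (weight (partialSum f) (nodes n) + weight (partialSum f) (risen n))
    ≡⟨ rotate (weight (catalanStep f) (nodes n)) (weight (partialSum f) (nodes n)) (weight (partialSum f) (risen n)) ⟩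
  weight (partialSum f) (nodes n) + weight (catalanStep f) (nodes n) + weight (partialSum f) (risen n)
    ≡⟨ weight-nodes-suc (partialSum f) n ⟨
  weight (partialSum f) (nodes (suc n)) ∎
  where
  rotate : ∀ a b c → a + (b + c) ≡ b + a + c
  rotate = solve-∀

weight-step : ∀ f n → weight f (nodes (suc n)) ≡ weight f (nodes n) + weight (catalanStep f) (nodes n)
weight-step f n = begin
  weight f (nodes (suc n))
    ≡⟨ weight-nodes-suc f n ⟩
  weight f (nodes n) + weight (f ∘ suc) (nodes n) + weight f (risen n)
    ≡⟨ cong (weight f (nodes n) + weight (f ∘ suc) (nodes n) +_) (weight-risen f n) ⟩
  weight f (nodes n) + weight (f ∘ suc) (nodes n) + weight (partialSum f) (nodes n)
    ≡⟨ rotate (weight f (nodes n)) (weight (f ∘ suc) (nodes n)) (weight (partialSum f) (nodes n)) ⟩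
  weight f (nodes n) + (weight (partialSum f) (nodes n) + weight (f ∘ suc) (nodes n))
    -- The labels 1, ..., p from the risen words and p + 1 from the shifts make up one step of the
    -- Catalan tree.
    ≡⟨ cong (weight f (nodes n) +_) (weight-+ (partialSum f) (f ∘ suc) (nodes n)) ⟨
  weight f (nodes n) + weight (catalanStep f) (nodes n) ∎
  where
  rotate : ∀ a b c → a + b + c ≡ a + (c + b)
  rotate = solve-∀

-- The parameter j makes the induction go through: each of the m steps keeps j or raises it by one,
-- and the coefficient counts the choices of k raising steps.
iterate-ballot : ∀ m j → weight (ballot j) (nodes m) ≡ sumBelow (λ k → (m C k) * ballot (k + j) 0) (suc m)
iterate-ballot zero    j = arith (ballot j 0)
  where
  arith : ∀ a → a + 0 ≡ 1 * a + 0
  arith = solve-∀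
iterate-ballot (suc m) j = begin
  weight (ballot j) (nodes (suc m))
    ≡⟨ weight-step (ballot j) m ⟩
  weight (ballot j) (nodes m) + weight (ballot (suc j)) (nodes m)
    ≡⟨ cong₂ _+_ (iterate-ballot m j) (iterate-ballot m (suc j)) ⟩
  sumBelow (λ k → (m C k) * ballot (k + j) 0) (suc m) + sumBelow (λ k → (m C k) * ballot (k + suc j) 0) (suc m)
    ≡⟨ cong (sumBelow (λ k → (m C k) * ballot (k + j) 0) (suc m) +_)
         (sumBelow-cong (λ k → cong (λ i → (m C k) * ballot i 0) (+-suc k j)) (suc m)) ⟩
  sumBelow (λ k → (m C k) * ballot (k + j) 0) (suc m) + sumBelow (λ k → (m C k) * ballot (suc k + j) 0) (suc m)
    ≡⟨ binomial-sum-suc (λ k → ballot (k + j) 0) m ⟨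
  sumBelow (λ k → (suc m C k) * ballot (k + j) 0) (suc (suc m)) ∎

length≡weight : ∀ us → length us ≡ weight (ballot 0) us
length≡weight []       = refl
length≡weight (u ∷ us) = cong suc (length≡weight us)

length-nodes : ∀ m → length (nodes m) ≡ sum (map (λ k → (m C k) * catalan k) (upTo (suc m)))
length-nodes m = begin
  length (nodes m)                                                 ≡⟨ length≡weight (nodes m) ⟩
  weight (ballot 0) (nodes m)                                      ≡⟨ iterate-ballot m 0 ⟩
  sumBelow (λ k → (m C k) * ballot (k + 0) 0) (suc m)
    ≡⟨ sumBelow-cong (λ k → cong ((m C k) *_) (trans (cong (λ i → ballot i 0) (+-identityʳ k)) (ballot-catalan k))) (suc m) ⟩
  sumBelow (λ k → (m C k) * catalan k) (suc m)                     ≡⟨ cong sum (map-upTo (λ k → (m C k) * catalan k) (suc m)) ⟨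
  sum (map (λ k → (m C k) * catalan k) (upTo (suc m)))             ∎

-- Soundness of the generating tree

record Sound (n : ℕ) (u : Node) : Set where
  constructor mkSound
  field
    valid      : Valid (proj₁ u)
    len        : length (proj₁ u) ≡ suc n
    admissible : Admissible (ascᴿ (proj₁ u)) (proj₁ u) (proj₂ u)
open Sound

-- The last letter heads the admissible list, since two zeros precede it and smaller nonzero letters
-- are forbidden. `afterNonzero` relies on this.
record Risen (u : Node) : Set where
  constructor mkRisen
  field
    {last}     : ℕ
    {init rest} : List ℕ
    word≡    : proj₁ u ≡ suc last ∷ init
    letters≡ : proj₂ u ≡ suc last ∷ rest
    twoZeros : TwoZeros init

allowed-admissible : ∀ {n u} → Sound n u → Admissible (suc (ascᴿ (proj₁ u))) (proj₁ u) (allowed u)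
allowed-admissible s = admissible-top (admissible s) (top-allowed (valid s))

appendZero-sound : ∀ {n u} → Sound n u → Sound (suc n) (appendZero u)
appendZero-sound {u = r , vs} (mkSound v l adm) = mkSound (snoc z≤n zero-allowed v) (cong suc l)
  (subst (λ t → Admissible t (0 ∷ r) vs) (sym (valid-head-zero v)) (admissible-zero adm))

prependZero-sound : ∀ {n u} → Sound n u → Sound (suc n) (prependZero u)
prependZero-sound {u = r , vs} (mkSound v l adm) = mkSound (valid-shift v)
  (trans (length-++ (map suc r)) (trans (+-comm _ 1) (cong suc (trans (length-map suc r) l))))
  (subst (λ t → Admissible t (shift r) (1 ∷ map suc vs)) (sym (ascᴿ-shift v)) (admissible-shift adm))

-- The list ps collects the letters already passed, so that admissibility of the whole list stays at
-- hand. As d lies below us, every appended letter makes an ascent.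
appendEach-sound : ∀ {n d r} ps us → Valid (d ∷ r) → length (d ∷ r) ≡ suc n → TwoZeros (d ∷ r) →
  Admissible (suc (ascᴿ (d ∷ r))) (d ∷ r) (ps ++ us) → All (d <_) us →
  All (λ u → Sound (suc n) u × Risen u) (appendEach (d ∷ r) us)
appendEach-sound ps []       v l 00⊆ adm _ = []
appendEach-sound {n} {d} {r} ps (c ∷ us) v l 00⊆ adm (d<c ∷ d<) with sound adm (∈-++⁺ʳ ps (here refl))
-- The match exposes c as a successor, as `Risen` demands.
... | s≤s z≤n , c≤ , ok =
  (mkSound (snoc c≤ ok v) (cong suc l)
      (subst (λ t → Admissible (t + ascᴿ (d ∷ r)) (c ∷ d ∷ r) (c ∷ us)) (sym (rise-< {r = r} d<c))
        (admissible-suffix ps 00⊆ adm))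
  , mkRisen refl refl 00⊆)
  ∷ appendEach-sound (ps ++ c ∷ []) us v l 00⊆
      (subst (Admissible _ _) (sym (++-assoc ps (c ∷ []) us)) adm) d<

afterZero-sound : ∀ {n u} → Sound n u → All (λ w → Sound (suc (suc n)) w × Risen w) (afterZero u)
afterZero-sound {u = u@(r , vs)} s@(mkSound v l adm) =
  appendEach-sound [] (allowed u) (valid s′) (len s′) (refl ∷ valid-∋0 v) adm′
    (All.tabulate λ e∈ → proj₁ (sound adm′ e∈))
  where
  s′ = appendZero-sound s
  adm′ : Admissible (suc (ascᴿ (0 ∷ r))) (0 ∷ r) (allowed u)
  adm′ = subst (λ t → Admissible (suc t) (0 ∷ r) (allowed u)) (sym (valid-head-zero v))
           (admissible-zero (allowed-admissible s))

afterNonzero-sound : ∀ {n u} → Sound n u → Risen u → All (λ w → Sound (suc n) w × Risen w) (afterNonzero u)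
afterNonzero-sound s@(mkSound v l adm) (mkRisen {c} {r} {ws} refl refl 00⊆) =
  (mkSound (snoc (m≤n⇒m≤1+n c≤) ok v) (cong suc l)
    (subst (λ t → Admissible (t + ascᴿ (suc c ∷ r)) (suc c ∷ suc c ∷ r) (suc c ∷ ws))
       (sym (rise-≥ {suc c} {r = r} ≤-refl)) (admissible-repeat adm))
  , mkRisen refl refl (_ ∷ʳ 00⊆))
  ∷ appendEach-sound (suc c ∷ []) (ws ++ suc (ascᴿ (suc c ∷ r)) ∷ []) v l (_ ∷ʳ 00⊆) adm′
      (AllPairs.head (increasing adm′))
  where
  adm′ = allowed-admissible s
  c≤ = proj₁ (proj₂ (sound adm (here refl)))
  ok = proj₂ (proj₂ (sound adm (here refl)))

mutual
  nodes-sound : ∀ n → All (Sound n) (nodes n)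
  nodes-sound zero    = mkSound start refl (record
    { increasing = [] ; sound = λ () ; complete = λ { (s≤s _) () _ } }) ∷ []
  nodes-sound (suc n) = All.++⁺ (All.map⁺ (All.map appendZero-sound (nodes-sound n)))
    (All.++⁺ (All.map⁺ (All.map prependZero-sound (nodes-sound n))) (All.map proj₁ (risen-sound n)))

  risen-sound : ∀ n → All (λ u → Sound (suc n) u × Risen u) (risen n)
  risen-sound zero    = []
  risen-sound (suc n) = All.++⁺
    (All.concat⁺ (All.map⁺ (All.map afterZero-sound (nodes-sound n))))
    (All.concat⁺ (All.map⁺ (All.map (λ (s , ρ) → afterNonzero-sound s ρ) (risen-sound n))))

-- Completeness of the generating tree

appendEach-∋ : ∀ r {c us} → c ∈ us → ∃[ ws ] ((c ∷ r , ws) ∈ appendEach r us)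
appendEach-∋ r (here refl) = _ , here refl
appendEach-∋ r (there c∈)  = let (ws , ∈ws) = appendEach-∋ r c∈ in ws , there ∈ws

concatMap-∋ : ∀ (f : Node → List Node) {us u w} → u ∈ us → w ∈ f u → w ∈ concatMap f us
concatMap-∋ f u∈ w∈ = ∈-concatMap⁺ f (Any.map (λ { refl → w∈ }) u∈)

mutual
  nodes-complete : ∀ n {r} → Valid r → length r ≡ suc n → ∃[ vs ] ((r , vs) ∈ nodes n)
  nodes-complete zero    start           refl = [] , here refl
  nodes-complete zero    (snoc _ _ start) ()
  nodes-complete zero    (snoc _ _ (snoc _ _ _)) ()
  nodes-complete (suc n) start           ()
  nodes-complete (suc n) (snoc {zero} _ _ v) l with nodes-complete n v (suc-injective l)
  ... | vs , ∈n = vs , ∈-++⁺ˡ (∈-map⁺ appendZero ∈n)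
  nodes-complete (suc n) v@(snoc {suc c} {r} _ _ _) l with valid-cases v
  ... | inj₁ 00⊆ = let (vs , ∈r) = risen-complete n v (twoZeros-suc⁻ 00⊆) (suc-injective l) in
                   vs , ∈-++⁺ʳ (map appendZero (nodes n)) (∈-++⁺ʳ (map prependZero (nodes n)) ∈r)
  ... | inj₂ (inj₂ (s , eq , w)) with nodes-complete n w
          (suc-injective (trans (sym (trans (length-++ (map suc s)) (trans (+-comm _ 1) (cong suc (length-map suc s)))))
            (trans (cong length (sym eq)) l)))
  ...   | vs , ∈n = _ , ∈-++⁺ʳ (map appendZero (nodes n)) (∈-++⁺ˡ
                      (subst (λ t → (t , 1 ∷ map suc vs) ∈ map prependZero (nodes n)) (sym eq)
                        (∈-map⁺ prependZero ∈n)))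

  risen-complete : ∀ n {c r} → Valid (suc c ∷ r) → TwoZeros r → length r ≡ suc n →
                   ∃[ vs ] ((suc c ∷ r , vs) ∈ risen n)
  risen-complete zero    {r = _ ∷ []} _ (_ ∷ʳ ()) _
  risen-complete zero    {r = _ ∷ []} _ (_ ∷ ()) _
  risen-complete (suc n) (snoc _ _ start) _ ()
  -- The last letter but one is 0, so two letters are removed and the parent lies in `nodes n`.
  risen-complete (suc n) {c} (snoc c≤ ok (snoc {zero} {r} _ _ v)) 00⊆ l with nodes-complete n v (suc-injective l)
  ... | vs , ∈n =
    let adm = allowed-admissible (All.lookup (nodes-sound n) ∈n)
        c∈  = complete adm (s≤s z≤n) (subst (λ t → suc c ≤ suc t) (valid-head-zero v) c≤) (ok ∘ forbidden-∷)
        (ws , ∈ws) = appendEach-∋ (0 ∷ r) c∈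
    in ws , ∈-++⁺ˡ (concatMap-∋ afterZero ∈n ∈ws)
  risen-complete (suc n) {c} (snoc c≤ ok v@(snoc {suc d} {r} _ _ _)) 00⊆ l
    with risen-complete n v (twoZeros-suc⁻ 00⊆) (suc-injective l)
  ... | vs , ∈r with All.lookup (risen-sound n) ∈r
  -- The last letter now heads the allowed list: the head is its repetition, the tail holds the
  -- larger letters.
  ...   | s , mkRisen refl refl _ with complete (allowed-admissible s) (s≤s z≤n) c≤ ok
  ...     | here refl = _ , ∈-++⁺ʳ (concatMap afterZero (nodes n)) (concatMap-∋ afterNonzero ∈r (here refl))
  ...     | there c∈  = let (ws , ∈ws) = appendEach-∋ (suc d ∷ r) c∈ in
    ws , ∈-++⁺ʳ (concatMap afterZero (nodes n)) (concatMap-∋ afterNonzero ∈r (there ∈ws))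

-- No word is generated twice

Distinct : Node → Node → Set
Distinct u w = proj₁ u ≢ proj₁ w

appendEach-tail : ∀ r us → All (λ w → ∃[ c ] proj₁ w ≡ c ∷ r) (appendEach r us)
appendEach-tail r []       = []
appendEach-tail r (c ∷ us) = (c , refl) ∷ appendEach-tail r us

appendEach-avoids : ∀ {d} r {us} → All (d <_) us → All (λ w → d ∷ r ≢ proj₁ w) (appendEach r us)
appendEach-avoids r []         = []
appendEach-avoids r (d<c ∷ d<) = (λ eq → <⇒≢ d<c (∷-injectiveˡ eq)) ∷ appendEach-avoids r d<

appendEach-distinct : ∀ r {us} → AllPairs _<_ us → AllPairs Distinct (appendEach r us)
appendEach-distinct r []         = []
appendEach-distinct r (c< ∷ inc) = appendEach-avoids r c< ∷ appendEach-distinct r inc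

afterNonzero-tail : ∀ {u} → Risen u → All (λ w → ∃[ c ] proj₁ w ≡ c ∷ proj₁ u) (afterNonzero u)
afterNonzero-tail {u} (mkRisen refl refl _) = (_ , refl) ∷ appendEach-tail (proj₁ u) (drop 1 (allowed u))

afterNonzero-distinct : ∀ {n u} → Sound n u → Risen u → AllPairs Distinct (afterNonzero u)
afterNonzero-distinct s (mkRisen refl refl _) with increasing (allowed-admissible s)
... | c< ∷ inc = appendEach-avoids _ c< ∷ appendEach-distinct _ inc

all-pairs : ∀ {us ws} {P Q : Node → Set} → (∀ {u w} → P u → Q w → Distinct u w) →
            All P us → All Q ws → All (λ u → All (Distinct u) ws) us
all-pairs ne ps qs = All.map (λ p → All.map (ne p) qs) ps

-- Each child puts one letter onto g of its parent's word, so equal children have equal parents by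
-- injectivity of g.
concatMap-distinct : ∀ (f : Node → List Node) (g : List ℕ → List ℕ) {us} →
  (∀ {r s} → g r ≡ g s → r ≡ s) →
  All (λ u → AllPairs Distinct (f u) × All (λ w → ∃[ c ] proj₁ w ≡ c ∷ g (proj₁ u)) (f u)) us →
  AllPairs Distinct us → AllPairs Distinct (concatMap f us)
concatMap-distinct f g {us} inj each ds =
  AllPairs.concat⁺ (All.map⁺ (All.map proj₁ each)) (AllPairs.map⁺ (across each ds))
  where
  across : ∀ {us} → All (λ u → AllPairs Distinct (f u) × All (λ w → ∃[ c ] proj₁ w ≡ c ∷ g (proj₁ u)) (f u)) us →
    AllPairs Distinct us → AllPairs (λ u w → All (λ x → All (Distinct x) (f w)) (f u)) us
  across []                    []       = []
  across ((_ , tails) ∷ each) (d ∷ ds) =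
    All.zipWith (λ (d , (_ , tails′)) → all-pairs
      (λ (_ , e) (_ , e′) eq → d (inj (∷-injectiveʳ (trans (sym e) (trans eq e′))))) tails tails′) (d , each)
    ∷ across each ds

mutual
  -- A final 0 marks the first class; the other two differ in having one zero or at least two.
  nodes-distinct : ∀ n → AllPairs Distinct (nodes n)
  nodes-distinct zero    = [] ∷ []
  nodes-distinct (suc n) = AllPairs.++⁺
    (AllPairs.map⁺ (AllPairs.map (λ d eq → d (∷-injectiveʳ eq)) (nodes-distinct n)))
    (AllPairs.++⁺
      (AllPairs.map⁺ (AllPairs.map (λ d eq → d (shift-injective eq)) (nodes-distinct n)))
      (risen-distinct n)
      (all-pairs (λ { (s , e) (mkRisen e′ _ 00⊆) eq →
                    shift-one-zero s (subst TwoZeros (trans (sym e′) (trans (sym eq) e)) (_ ∷ʳ 00⊆)) })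
         shifted (All.map proj₂ (risen-sound n))))
    (all-pairs {P = λ u → ∃[ r ] proj₁ u ≡ 0 ∷ r} {Q = λ u → ∃[ c ] ∃[ r ] proj₁ u ≡ suc c ∷ r}
      (λ { (_ , e) (_ , _ , e′) eq → 0≢1+n (∷-injectiveˡ (trans (sym e) (trans eq e′))) })
      (All.map⁺ (All.universal (λ u → _ , refl) (nodes n)))
      (All.++⁺ (All.map⁺ (All.map (λ {u} → head-positive {u}) (All.map valid (nodes-sound n))))
        (All.map (λ (_ , ρ) → _ , _ , Risen.word≡ ρ) (risen-sound n))))
    where
    shifted : All (λ u → ∃[ s ] proj₁ u ≡ shift s) (map prependZero (nodes n))
    shifted = All.map⁺ (All.universal (λ u → proj₁ u , refl) (nodes n))
    head-positive : ∀ {u} → Valid (proj₁ u) → ∃[ c ] ∃[ r ] proj₁ (prependZero u) ≡ suc c ∷ r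
    head-positive start        = _ , _ , refl
    head-positive (snoc _ _ _) = _ , _ , refl

  -- The two families differ in the last letter but one, which is 0 or positive.
  risen-distinct : ∀ n → AllPairs Distinct (risen n)
  risen-distinct zero    = []
  risen-distinct (suc n) = AllPairs.++⁺
    (concatMap-distinct afterZero (0 ∷_) ∷-injectiveʳ
      (All.map (λ {u} s → appendEach-distinct _ (increasing (allowed-admissible s)) , appendEach-tail _ (allowed u))
        (nodes-sound n))
      (nodes-distinct n))
    (concatMap-distinct afterNonzero (λ r → r) (λ eq → eq)
      (All.map (λ (s , ρ) → afterNonzero-distinct s ρ , afterNonzero-tail ρ) (risen-sound n))
      (risen-distinct n))
    (all-pairs {P = λ u → ∃[ c ] ∃[ r ] proj₁ u ≡ c ∷ 0 ∷ r} {Q = λ u → ∃[ c ] ∃[ d ] ∃[ r ] proj₁ u ≡ c ∷ suc d ∷ r}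
      (λ { (_ , _ , e) (_ , _ , _ , e′) eq →
           0≢1+n (∷-injectiveˡ (∷-injectiveʳ (trans (sym e) (trans eq e′)))) })
      (All.concat⁺ (All.map⁺ (All.universal
        (λ u → All.map (λ (c , e) → c , _ , e) (appendEach-tail (0 ∷ proj₁ u) (allowed u))) (nodes n))))
      (All.concat⁺ (All.map⁺ (All.map
        (λ { (_ , ρ@(mkRisen refl refl _)) → All.map (λ (c , e) → c , _ , _ , e) (afterNonzero-tail ρ) })
        (risen-sound n)))))

-- Translation to patterns and prefixes

pattern0021 : List ℕ
pattern0021 = 0 ∷ 0 ∷ 2 ∷ 1 ∷ []

-- The length of this list is the value that `red y` gives to v.
smaller : ℕ → List ℕ → List ℕ
smaller v y = deduplicate _≟_ (filter (_<? v) y)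

∈-smaller : ∀ {e v y} → e ∈ y → e < v → e ∈ smaller v y
∈-smaller {v = v} e∈y e<v = ∈-deduplicate⁺ _≟_ (∈-filter⁺ (_<? v) e∈y e<v)

rank-zero : ∀ {e v y} → e ∈ y → length (smaller v y) ≡ 0 → v ≤ e
rank-zero {v = v} {y} e∈y eq = ≮⇒≥ (λ e<v → empty (smaller v y) eq (∈-smaller e∈y e<v))
  where
  empty : ∀ xs {e : ℕ} → length xs ≡ 0 → ¬ e ∈ xs
  empty [] _ ()

rank-one : ∀ {d e v y} → d ∈ y → e ∈ y → length (smaller v y) ≡ 1 → d < v → e < v → d ≡ e
rank-one {v = v} {y} d∈y e∈y eq d<v e<v = single (smaller v y) eq (∈-smaller d∈y d<v) (∈-smaller e∈y e<v)
  where
  single : ∀ xs {d e : ℕ} → length xs ≡ 1 → d ∈ xs → e ∈ xs → d ≡ e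
  single (_ ∷ []) _ (here refl) (here refl) = refl

red⇒0021 : ∀ y → red y ≡ pattern0021 → ∃[ a ] ∃[ b ] ∃[ c ] (a < b × b < c × y ≡ a ∷ a ∷ c ∷ b ∷ [])
red⇒0021 y@(w ∷ x ∷ c ∷ b ∷ []) eq = order w≡x
  where
  rank : ℕ → ℕ
  rank v = length (smaller v y)
  rank-w : rank w ≡ 0
  rank-w = ∷-injectiveˡ eq
  rank-x : rank x ≡ 0
  rank-x = ∷-injectiveˡ (∷-injectiveʳ eq)
  rank-c : rank c ≡ 2
  rank-c = ∷-injectiveˡ (∷-injectiveʳ (∷-injectiveʳ eq))
  rank-b : rank b ≡ 1
  rank-b = ∷-injectiveˡ (∷-injectiveʳ (∷-injectiveʳ (∷-injectiveʳ eq)))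
  distinct-ranks : ∀ {u v i j} → rank u ≡ i → rank v ≡ j → i ≢ j → u ≢ v
  distinct-ranks ru rv i≢j refl = i≢j (trans (sym ru) rv)
  w≡x : w ≡ x
  w≡x = ≤-antisym (rank-zero {y = y} (there (here refl)) rank-w) (rank-zero {y = y} (here refl) rank-x)
  w<b : w < b
  w<b = ≤∧≢⇒< (rank-zero {y = y} (there (there (there (here refl)))) rank-w) (distinct-ranks rank-w rank-b λ ())
  w<c : w < c
  w<c = ≤∧≢⇒< (rank-zero {y = y} (there (there (here refl))) rank-w) (distinct-ranks rank-w rank-c λ ())
  b<c : b < c
  b<c with <-cmp b c
  ... | tri< b<c _ _ = b<c
  ... | tri≈ _ b≡c _ = contradiction b≡c (distinct-ranks rank-b rank-c λ ())
  -- Otherwise w and c would both lie below b, while rank 1 permits a single smaller value.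
  ... | tri> _ _ c<b = contradiction
          (rank-one {y = y} (here refl) (there (there (here refl))) rank-b w<b c<b) (<⇒≢ w<c)
  order : w ≡ x → ∃[ a ] ∃[ b′ ] ∃[ c′ ] (a < b′ × b′ < c′ × y ≡ a ∷ a ∷ c′ ∷ b′ ∷ [])
  order refl = w , b , c , w<b , b<c , refl

0021⇒red : ∀ {a b c} → a < b → b < c → red (a ∷ a ∷ c ∷ b ∷ []) ≡ pattern0021
0021⇒red {a} {b} {c} a<b b<c = cong₂ _∷_ rank-a (cong₂ _∷_ rank-a (cong₂ _∷_ rank-c (cong (_∷ []) rank-b)))
  where
  a<c = <-trans a<b b<c
  y = a ∷ a ∷ c ∷ b ∷ []
  acc : ∀ v {e} es → e < v → filter (_<? v) (e ∷ es) ≡ e ∷ filter (_<? v) es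
  acc v es = filter-accept (_<? v)
  rej : ∀ v {e} es → v ≤ e → filter (_<? v) (e ∷ es) ≡ filter (_<? v) es
  rej v es v≤e = filter-reject (_<? v) (≤⇒≯ v≤e)
  dedup-a : deduplicate _≟_ (a ∷ a ∷ []) ≡ a ∷ []
  dedup-a = cong (a ∷_) (filter-reject (¬? ∘ (a ≟_)) (λ a≢a → a≢a refl))
  below-b : filter (_<? b) y ≡ a ∷ a ∷ []
  below-b = trans (acc b _ a<b) (cong (a ∷_) (trans (acc b _ a<b) (cong (a ∷_)
    (trans (rej b (b ∷ []) (<⇒≤ b<c)) (rej b [] ≤-refl)))))
  below-c : filter (_<? c) y ≡ a ∷ a ∷ b ∷ []
  below-c = trans (acc c _ a<c) (cong (a ∷_) (trans (acc c _ a<c) (cong (a ∷_)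
    (trans (rej c (b ∷ []) ≤-refl) (acc c [] b<c)))))
  dedup-ab : deduplicate _≟_ (a ∷ a ∷ b ∷ []) ≡ a ∷ b ∷ []
  dedup-ab = cong (a ∷_) (trans (filter-reject (¬? ∘ (a ≟_)) (λ a≢a → a≢a refl))
    -- The letter b passes two filters, one for each copy of a.
    (trans (cong (filter (¬? ∘ (a ≟_))) b-kept) b-kept))
    where
    b-kept : filter (¬? ∘ (a ≟_)) (b ∷ []) ≡ b ∷ []
    b-kept = filter-accept (¬? ∘ (a ≟_)) (<⇒≢ a<b)
  rank-a : length (smaller a y) ≡ 0
  rank-a = cong (length ∘ deduplicate _≟_) (filter-none (_<? a)
    (≤⇒≯ ≤-refl ∷ ≤⇒≯ ≤-refl ∷ ≤⇒≯ (<⇒≤ a<c) ∷ ≤⇒≯ (<⇒≤ a<b) ∷ []))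
  rank-b : length (smaller b y) ≡ 1
  rank-b = cong length (trans (cong (deduplicate _≟_) below-b) dedup-a)
  rank-c : length (smaller c y) ≡ 2
  rank-c = cong length (trans (cong (deduplicate _≟_) below-c) dedup-ab)

Pattern : List ℕ → Set
Pattern r = ∃[ b ] ∃[ a ] ∃[ c ] (a < b × b < c × b ∷ c ∷ a ∷ a ∷ [] ⊆ r)

contains⇒pattern : ∀ {r} → Contains (reverse r) pattern0021 → Pattern r
contains⇒pattern {r} (y , y⊆ , eq) with red⇒0021 y eq
... | a , b , c , a<b , b<c , refl =
  b , a , c , a<b , b<c , subst (_ ⊆_) (reverse-involutive r) (reverse⁺ y⊆)

pattern⇒contains : ∀ {r} → Pattern r → Contains (reverse r) pattern0021
pattern⇒contains (b , a , c , a<b , b<c , p) = _ , reverse⁺ p , 0021⇒red a<b b<c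

pattern-∷⁻ : ∀ {c r} → Pattern (c ∷ r) → Forbidden r c ⊎ Pattern r
pattern-∷⁻ (b , a , d , a<b , b<d , (refl ∷ p)) = inj₁ (a , d , a<b , b<d , p)
pattern-∷⁻ (b , a , d , a<b , b<d , (_ ∷ʳ p))   = inj₂ (b , a , d , a<b , b<d , p)

pattern-here : ∀ {c r} → Forbidden r c → Pattern (c ∷ r)
pattern-here {c} (a , d , a<c , c<d , p) = c , a , d , a<c , c<d , refl ∷ p

pattern-there : ∀ {c r} → Pattern r → Pattern (c ∷ r)
pattern-there (b , a , d , a<b , b<d , p) = b , a , d , a<b , b<d , _ ∷ʳ p

valid⇒no-pattern : ∀ {r} → Valid r → ¬ Pattern r
valid⇒no-pattern start (_ , _ , _ , _ , _ , (_ ∷ʳ ()))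
valid⇒no-pattern start (_ , _ , _ , _ , _ , (_ ∷ ()))
valid⇒no-pattern (snoc _ ok v) p with pattern-∷⁻ p
... | inj₁ bad = ok bad
... | inj₂ p′  = valid⇒no-pattern v p′

-- `asc` recurses from the front whereas words grow at the end; this splits off the comparison of
-- the last two letters.
asc-∷ʳ : ∀ x xs c d → asc (x ∷ xs ++ d ∷ c ∷ []) ≡ asc (x ∷ xs ++ d ∷ []) + (if d <ᵇ c then 1 else 0)
asc-∷ʳ x [] c d = trans (cong ((if x <ᵇ d then 1 else 0) +_) (+-identityʳ _))
  (cong (_+ (if d <ᵇ c then 1 else 0)) (sym (+-identityʳ (if x <ᵇ d then 1 else 0))))
asc-∷ʳ x (y ∷ xs) c d = trans (cong ((if x <ᵇ y then 1 else 0) +_) (asc-∷ʳ y xs c d))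
  (sym (+-assoc (if x <ᵇ y then 1 else 0) _ _))

asc-reverse : ∀ r → asc (reverse r) ≡ ascᴿ r
asc-reverse []          = refl
asc-reverse (c ∷ [])    = refl
asc-reverse (c ∷ d ∷ r) = begin
  asc (reverse (c ∷ d ∷ r))              ≡⟨ cong asc (ʳ++-defn r) ⟩
  asc (reverse r ++ d ∷ c ∷ [])          ≡⟨ split (reverse r) ⟩
  asc (reverse r ++ d ∷ []) + rise c (d ∷ r) ≡⟨ cong (λ l → asc l + rise c (d ∷ r)) (unfold-reverse d r) ⟨
  asc (reverse (d ∷ r)) + rise c (d ∷ r) ≡⟨ cong (_+ rise c (d ∷ r)) (asc-reverse (d ∷ r)) ⟩
  ascᴿ (d ∷ r) + rise c (d ∷ r)          ≡⟨ +-comm (ascᴿ (d ∷ r)) (rise c (d ∷ r)) ⟩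
  ascᴿ (c ∷ d ∷ r)                       ∎
  where
  split : ∀ l → asc (l ++ d ∷ c ∷ []) ≡ asc (l ++ d ∷ []) + (if d <ᵇ c then 1 else 0)
  split []      = +-identityʳ _
  split (x ∷ l) = asc-∷ʳ x l c d

asc-bound : ∀ r → asc (reverse r) + 1 ≡ suc (ascᴿ r)
asc-bound r = trans (+-comm _ 1) (cong suc (asc-reverse r))

-- Avoidance is assumed for the complete word only: an occurrence in a prefix persists in every
-- extension.
ascentFrom⇒valid : ∀ {r} xs → IsAscentFrom (reverse r) xs → Valid r → ¬ Pattern (xs ʳ++ r) → Valid (xs ʳ++ r)
ascentFrom⇒valid []       done        v _  = v
ascentFrom⇒valid {r} (x ∷ xs) (step x≤ h) v np = ascentFrom⇒valid xs
  (subst (λ p → IsAscentFrom p xs) (sym (unfold-reverse x r)) h)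
  (snoc (subst (x ≤_) (asc-bound r) x≤) (λ bad → np (pattern-ʳ++ xs (pattern-here bad))) v) np
  where
  pattern-ʳ++ : ∀ xs {r} → Pattern r → Pattern (xs ʳ++ r)
  pattern-ʳ++ []       p = p
  pattern-ʳ++ (x ∷ xs) p = pattern-ʳ++ xs (pattern-there p)

ascentSequence⇒valid : ∀ {m} x → IsAscentSequence x → length x ≡ suc m → Avoids x pattern0021 → Valid (reverse x)
ascentSequence⇒valid (.0 ∷ xs) (refl , h) _ av = ascentFrom⇒valid xs h start
  (λ p → av (subst (λ l → Contains l pattern0021) (reverse-involutive (0 ∷ xs)) (pattern⇒contains p)))

ascentFrom-∷ʳ : ∀ {p} xs {c} → IsAscentFrom p xs → c ≤ asc (p ++ xs) + 1 → IsAscentFrom p (xs ++ c ∷ [])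
ascentFrom-∷ʳ {p} []       done        c≤ = step (subst (λ l → _ ≤ asc l + 1) (++-identityʳ p) c≤) done
ascentFrom-∷ʳ {p} (x ∷ xs) (step x≤ h) c≤ =
  step x≤ (ascentFrom-∷ʳ xs h (subst (λ l → _ ≤ asc l + 1) (sym (++-assoc p (x ∷ []) xs)) c≤))

ascentSequence-∷ʳ : ∀ x {c} → x ≢ [] → IsAscentSequence x → c ≤ asc x + 1 → IsAscentSequence (x ++ c ∷ [])
ascentSequence-∷ʳ []       ne _          _  = contradiction refl ne
ascentSequence-∷ʳ (x ∷ xs) _  (x≡0 , h) c≤ = x≡0 , ascentFrom-∷ʳ xs h c≤

valid⇒ascentSequence : ∀ {r} → Valid r → IsAscentSequence (reverse r)
valid⇒ascentSequence start = refl , done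
valid⇒ascentSequence (snoc {c} {r} c≤ _ v) = subst IsAscentSequence (sym (unfold-reverse c r))
  (ascentSequence-∷ʳ (reverse r) (nonempty v ∘ reverse-injective) (valid⇒ascentSequence v)
    (subst (c ≤_) (sym (asc-bound r)) c≤))
  where
  nonempty : ∀ {r} → Valid r → r ≢ []
  nonempty start        ()
  nonempty (snoc _ _ _) ()

theorem4 : (m : ℕ) → ∃[ L ] (Unique L
    × ((x : List ℕ) → (x ∈ L) ⇔ (IsAscentSequence x × length x ≡ suc m × Avoids x (0 ∷ 0 ∷ 2 ∷ 1 ∷ [])))
    × length L ≡ sum (map (λ k → (m C k) * catalan k) (upTo (suc m))))
theorem4 m = L , unique , (λ x → mk⇔ sound⇒ ⇐complete) , trans (length-map word (nodes m)) (length-nodes m)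
  where
  word : Node → List ℕ
  word u = reverse (proj₁ u)
  L : List (List ℕ)
  L = map word (nodes m)
  unique : Unique L
  unique = AllPairs.map⁺ (AllPairs.map (λ d eq → d (reverse-injective eq)) (nodes-distinct m))
  sound⇒ : ∀ {x} → x ∈ L → IsAscentSequence x × length x ≡ suc m × Avoids x pattern0021
  sound⇒ x∈ with ∈-map⁻ word x∈
  ... | (r , _) , ∈n , refl with All.lookup (nodes-sound m) ∈n
  ...   | mkSound v l _ =
    valid⇒ascentSequence v , trans (length-reverse r) l , valid⇒no-pattern v ∘ contains⇒pattern
  ⇐complete : ∀ {x} → IsAscentSequence x × length x ≡ suc m × Avoids x pattern0021 → x ∈ L
  ⇐complete {x} (a , l , av) with nodes-complete m (ascentSequence⇒valid x a l av) (trans (length-reverse x) l)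
  ... | vs , ∈n = subst (_∈ L) (reverse-involutive x) (∈-map⁺ word ∈n)
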